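{- Let $d\ge 1$ be an integer and let $\mathcal{B}_d$ be the complete binary matroid on $\mathbb{F}_2^d$. Let $\mathcal{P}$ be any partition matroid with (possibly empty) parts $P_1,\dots,P_d$ that is a reduction of $\mathcal{B}_d$. Then there is a subset $T\subseteq[d]$ with $|T|\ge d-8\sqrt{d}$ and $\left|\bigcup_{i\in T}P_i\right|\le \frac{2^d}{\sqrt[4]{d}}$.
   Context: $[d]=\{1,\dots,d\}$. The complete binary matroid $\mathcal{B}_d$ has ground set $\mathbb{F}_2^d$ (all $2^d$ vectors, including $0$), and a set $S\subseteq\mathbb{F}_2^d$ is independent iff the vectors of $S$ are linearly independent over $\mathbb{F}_2$. A matroid $\mathcal{M}'=(E',\mathcal{I}')$ is a reduction of a matroid $\mathcal{M}=(E,\mathcal{I})$ if $E'\subseteq E$ and $\mathcal{I}'\subseteq\mathcal{I}$ (every independent set of $\mathcal{M}'$ is independent in $\mathcal{M}$). A partition matroid with parts $P_1,\dots,P_d$ has ground set the disjoint union $P_1\cup\dots\cup P_d$ (parts may be empty), and a set $S$ is independent iff $|S\cap P_i|\le 1$ for all $i$. -}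

module Defs where

open import Data.Bool using (Bool; true; false; _∧_; _xor_; not; T)
open import Data.Nat using (ℕ; zero; suc; _≤_)
open import Data.Fin using (Fin)
open import Data.Vec using (Vec; []; _∷_; replicate; zipWith; lookup)
open import Data.List using (List; []; _∷_; map; _++_; filterᵇ; length; foldr; allFin)
open import Data.Bool.ListAction using (any)
open import Data.Product using (_×_)
open import Data.Fin.Subset using (Subset)
open import Data.Empty using (⊥)
open import Relation.Binary.PropositionalEquality using (_≡_; _≢_)

F₂^ : ℕ → Set
F₂^ d = Vec Bool d

allVecs : (d : ℕ) → List (F₂^ d)
allVecs zero = [] ∷ []
allVecs (suc d) = map (false ∷_) (allVecs d) ++ map (true ∷_) (allVecs d)

VSet : ℕ → Set
VSet d = F₂^ d → Bool

card : {d : ℕ} → VSet d → ℕ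
card {d} S = length (filterᵇ S (allVecs d))

_⊆ᵥ_ : {d : ℕ} → VSet d → VSet d → Set
_⊆ᵥ_ {d} R S = (v : F₂^ d) → T (R v) → T (S v)

zeroVec : (d : ℕ) → F₂^ d
zeroVec d = replicate d false

vsum : {d : ℕ} → VSet d → F₂^ d
vsum {d} R = foldr (zipWith _xor_) (zeroVec d) (filterᵇ R (allVecs d))

-- Independence in the complete binary matroid B_d:
-- S is linearly independent over F₂ iff no nonempty subset of S sums to 0.
IndepB : {d : ℕ} → VSet d → Set
IndepB {d} S = (R : VSet d) → R ⊆ᵥ S → vsum R ≡ zeroVec d → card R ≡ 0

Parts : ℕ → Set
Parts d = Fin d → VSet d

ground : {d : ℕ} → Parts d → VSet d
ground {d} P v = any (λ i → P i v) (allFin d)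

Disjoint : {d : ℕ} → Parts d → Set
Disjoint {d} P = (i j : Fin d) → i ≢ j → (v : F₂^ d) → T (P i v) → T (P j v) → ⊥

IndepP : {d : ℕ} → Parts d → VSet d → Set
IndepP {d} P S = (S ⊆ᵥ ground P) × ((i : Fin d) → card (λ v → S v ∧ P i v) ≤ 1)

-- The partition matroid with parts P is a reduction of B_d
-- (ground set ⊆ F₂^d automatically; every independent set is independent in B_d).
IsReduction : {d : ℕ} → Parts d → Set
IsReduction {d} P = Disjoint P × ((S : VSet d) → IndepP P S → IndepB S)

unionOver : {d : ℕ} → Subset d → Parts d → VSet d
unionOver {d} Tₛ P v = any (λ i → lookup Tₛ i ∧ P i v) (allFin d)

{-# OPTIONS --safe #-}

-- Call a part small if its size s satisfies 64 d s² ≤ 4^d; since the parts are disjoint, at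
-- most 8√d of them are not small.  Let U be the union of the small parts.  For a fixed t, any two
-- pairs (x , t + x) in U × U joining different parts must have a part in common, as
-- otherwise four vectors from distinct parts would sum to 0.  Hence there are at most 4s
-- such pairs for each t, and together with the at most 2^d s pairs inside one part this gives
-- |U|² ≤ 5 s 2^d.
module Submission where

open import Defs
open import Data.Bool using (Bool; true; false; _∧_; _xor_; not; T; if_then_else_)
open import Data.Bool.ListAction using (any)
open import Data.Bool.Properties using (T-∧; xor-assoc; xor-comm; xor-same)
open import Data.Fin using (Fin; zero; suc)
open import Data.Fin.Properties using (_≟_) renaming (suc-injective to Fin-suc-injective)
open import Data.Fin.Subset using (Subset; ∣_∣)
open import Data.Fin.Subset.Properties using (∣p∣≤n)
open import Data.List using (List; []; _∷_; map; _++_; filterᵇ; length; foldr; allFin)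
open import Data.List.Membership.Propositional using (_∈_; lose)
open import Data.List.Membership.Propositional.Properties using (∈-allFin; ∈-map⁺)
open import Data.List.Properties using (length-++; length-map; filter-++)
open import Data.List.Relation.Unary.All as All using (All; []; _∷_)
open import Data.List.Relation.Unary.AllPairs using ([]; _∷_)
open import Data.List.Relation.Unary.Any using (here; there; satisfied)
open import Data.List.Relation.Unary.Any.Properties using (any⁺; any⁻)
open import Data.List.Relation.Unary.Unique.Propositional using (Unique)
open import Data.Nat using (ℕ; zero; suc; _+_; _≤_; _<_; _∸_; _*_; _^_; _≤ᵇ_; z≤n; s≤s; _<?_)
open import Data.Nat.Properties hiding (_≟_)
open import Data.Nat.Tactic.RingSolver using (solve-∀)
open import Data.Product using (_×_; _,_; proj₁; proj₂; ∃-syntax)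
open import Data.Sum using (_⊎_; inj₁; inj₂)
open import Data.Vec using ([]; _∷_; lookup; tabulate; zipWith)
open import Data.Vec.Properties using (lookup∘tabulate; zipWith-assoc; zipWith-comm; zipWith-identityˡ; zipWith-identityʳ)
open import Function using (_∘_)
open import Function.Bundles using (Equivalence)
open import Relation.Binary.PropositionalEquality using (_≡_; _≢_; refl; sym; trans; cong; cong₂; subst; subst₂)
open import Relation.Nullary using (¬_; yes; no; contradiction; T?)
open import Algebra.Properties.CommutativeMonoid.Sum +-0-commutativeMonoid using (sum)

private
  variable
    d n : ℕ

∧-split : ∀ {a b} → T (a ∧ b) → T a × T b
∧-split = Equivalence.to T-∧

∧-join : ∀ {a b} → T a → T b → T (a ∧ b)
∧-join p q = Equivalence.from T-∧ (p , q)

ind : Bool → ℕ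
ind b = if b then 1 else 0

ind-T : ∀ {b} → T b → ind b ≡ 1
ind-T {true} _ = refl

-- Sums over F₂^d

∑ᵥ : (F₂^ d → ℕ) → ℕ
∑ᵥ {zero} f = f []
∑ᵥ {suc d} f = ∑ᵥ (f ∘ (false ∷_)) + ∑ᵥ (f ∘ (true ∷_))

∑ᵥ-mono : {f g : F₂^ d → ℕ} → (∀ v → f v ≤ g v) → ∑ᵥ f ≤ ∑ᵥ g
∑ᵥ-mono {zero} h = h []
∑ᵥ-mono {suc d} h = +-mono-≤ (∑ᵥ-mono (h ∘ (false ∷_))) (∑ᵥ-mono (h ∘ (true ∷_)))

∑ᵥ-cong : {f g : F₂^ d → ℕ} → (∀ v → f v ≡ g v) → ∑ᵥ f ≡ ∑ᵥ g
∑ᵥ-cong h = ≤-antisym (∑ᵥ-mono (≤-reflexive ∘ h)) (∑ᵥ-mono (≤-reflexive ∘ sym ∘ h))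

interchange : ∀ a b c e → (a + b) + (c + e) ≡ (a + c) + (b + e)
interchange = solve-∀

∑ᵥ-+ : (f g : F₂^ d → ℕ) → ∑ᵥ (λ v → f v + g v) ≡ ∑ᵥ f + ∑ᵥ g
∑ᵥ-+ {zero} f g = refl
∑ᵥ-+ {suc d} f g =
  trans (cong₂ _+_ (∑ᵥ-+ (f ∘ (false ∷_)) (g ∘ (false ∷_))) (∑ᵥ-+ (f ∘ (true ∷_)) (g ∘ (true ∷_))))
        (interchange (∑ᵥ (f ∘ (false ∷_))) _ _ _)

∑ᵥ-const : ∀ d c → ∑ᵥ {d} (λ _ → c) ≡ 2 ^ d * c
∑ᵥ-const zero c = sym (+-identityʳ c)
∑ᵥ-const (suc d) c = trans (cong₂ _+_ (∑ᵥ-const d c) (∑ᵥ-const d c)) (double (2 ^ d) c)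
  where
  double : ∀ m c → m * c + m * c ≡ (m + (m + 0)) * c
  double = solve-∀

∑ᵥ-≤const : {f : F₂^ d → ℕ} (c : ℕ) → (∀ v → f v ≤ c) → ∑ᵥ f ≤ 2 ^ d * c
∑ᵥ-≤const {d} c h = ≤-trans (∑ᵥ-mono h) (≤-reflexive (∑ᵥ-const d c))

∑ᵥ-*ʳ : (f : F₂^ d → ℕ) (c : ℕ) → ∑ᵥ (λ v → f v * c) ≡ ∑ᵥ f * c
∑ᵥ-*ʳ {zero} f c = refl
∑ᵥ-*ʳ {suc d} f c =
  trans (cong₂ _+_ (∑ᵥ-*ʳ (f ∘ (false ∷_)) c) (∑ᵥ-*ʳ (f ∘ (true ∷_)) c))
        (sym (*-distribʳ-+ c (∑ᵥ (f ∘ (false ∷_))) _))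

∑ᵥ-*ˡ : (c : ℕ) (f : F₂^ d → ℕ) → ∑ᵥ (λ v → c * f v) ≡ c * ∑ᵥ f
∑ᵥ-*ˡ c f = trans (∑ᵥ-cong (λ v → *-comm c (f v))) (trans (∑ᵥ-*ʳ f c) (*-comm (∑ᵥ f) c))

∑ᵥ-swap : (f : F₂^ d → F₂^ n → ℕ) → ∑ᵥ (λ v → ∑ᵥ (f v)) ≡ ∑ᵥ (λ w → ∑ᵥ (λ v → f v w))
∑ᵥ-swap {zero} f = refl
∑ᵥ-swap {suc d} f =
  trans (cong₂ _+_ (∑ᵥ-swap (f ∘ (false ∷_))) (∑ᵥ-swap (f ∘ (true ∷_)))) 
        (sym (∑ᵥ-+ (λ w → ∑ᵥ (λ v → f (false ∷ v) w)) _))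

infixl 6 _⊕_

_⊕_ : F₂^ d → F₂^ d → F₂^ d
_⊕_ = zipWith _xor_

-- Translation by `t` permutes the space: a leading `true` swaps the two halves of the sum, a
-- leading `false` keeps them. This allows a pair of vectors to be indexed by one vector and the sum
-- `t` of both.
∑ᵥ-shiftˡ : (t : F₂^ d) (f : F₂^ d → ℕ) → ∑ᵥ (λ v → f (t ⊕ v)) ≡ ∑ᵥ f
∑ᵥ-shiftˡ [] f = refl
∑ᵥ-shiftˡ (false ∷ t) f =
  cong₂ _+_ (∑ᵥ-shiftˡ t (f ∘ (false ∷_))) (∑ᵥ-shiftˡ t (f ∘ (true ∷_)))
∑ᵥ-shiftˡ (true ∷ t) f =
  trans (cong₂ _+_ (∑ᵥ-shiftˡ t (f ∘ (true ∷_))) (∑ᵥ-shiftˡ t (f ∘ (false ∷_))))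
        (+-comm (∑ᵥ (f ∘ (true ∷_))) _)

⊕-comm : (v w : F₂^ d) → v ⊕ w ≡ w ⊕ v
⊕-comm = zipWith-comm xor-comm

⊕-assoc : (u v w : F₂^ d) → (u ⊕ v) ⊕ w ≡ u ⊕ (v ⊕ w)
⊕-assoc = zipWith-assoc xor-assoc

⊕-identityˡ : (v : F₂^ d) → zeroVec d ⊕ v ≡ v
⊕-identityˡ = zipWith-identityˡ (λ _ → refl)

⊕-same : (v : F₂^ d) → v ⊕ v ≡ zeroVec d
⊕-same [] = refl
⊕-same (a ∷ v) = cong₂ _∷_ (xor-same a) (⊕-same v)

⊕-cancel : (v w : F₂^ d) → v ⊕ (v ⊕ w) ≡ w
⊕-cancel v w = trans (sym (⊕-assoc v v w)) (trans (cong (_⊕ w) (⊕-same v)) (⊕-identityˡ w))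

∑ᵥ-shiftʳ : (t : F₂^ d) (f : F₂^ d → ℕ) → ∑ᵥ (λ v → f (v ⊕ t)) ≡ ∑ᵥ f
∑ᵥ-shiftʳ t f = trans (∑ᵥ-cong (λ v → cong f (⊕-comm v t))) (∑ᵥ-shiftˡ t f)

-- Cardinalities

filterᵇ-map : {A B : Set} (p : B → Bool) (f : A → B) (xs : List A) →
  filterᵇ p (map f xs) ≡ map f (filterᵇ (p ∘ f) xs)
filterᵇ-map p f [] = refl
filterᵇ-map p f (x ∷ xs) with p (f x)
... | true = cong (f x ∷_) (filterᵇ-map p f xs)
... | false = filterᵇ-map p f xs

filterᵇ-allVecs : (S : VSet (suc d)) → filterᵇ S (allVecs (suc d)) ≡
  map (false ∷_) (filterᵇ (S ∘ (false ∷_)) (allVecs d)) ++ map (true ∷_) (filterᵇ (S ∘ (true ∷_)) (allVecs d))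
filterᵇ-allVecs {d} S =
  trans (filter-++ (T? ∘ S) (map (false ∷_) (allVecs d)) _)
        (cong₂ _++_ (filterᵇ-map S (false ∷_) (allVecs d)) (filterᵇ-map S (true ∷_) (allVecs d)))

-- Turns list lengths into sums of indicators, where translation and exchange of summation are
-- available.
card≡∑ᵥ : (S : VSet d) → card S ≡ ∑ᵥ (ind ∘ S)
card≡∑ᵥ {zero} S with S []
... | true = refl
... | false = refl
card≡∑ᵥ {suc d} S =
  trans (cong length (filterᵇ-allVecs S))
  (trans (length-++ (map (false ∷_) (filterᵇ (S ∘ (false ∷_)) (allVecs d))))
  (cong₂ _+_ (trans (length-map (false ∷_) (filterᵇ (S ∘ (false ∷_)) (allVecs d))) (card≡∑ᵥ (S ∘ (false ∷_))))
             (trans (length-map (true ∷_) (filterᵇ (S ∘ (true ∷_)) (allVecs d))) (card≡∑ᵥ (S ∘ (true ∷_))))))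

card-mono : {A B : VSet d} → A ⊆ᵥ B → card A ≤ card B
card-mono {A = A} {B} A⊆B =
  subst₂ _≤_ (sym (card≡∑ᵥ A)) (sym (card≡∑ᵥ B)) (∑ᵥ-mono (λ v → ind-mono (A⊆B v)))
  where
  ind-mono : ∀ {a b} → (T a → T b) → ind a ≤ ind b
  ind-mono {false} _ = z≤n
  ind-mono {true} {true} _ = ≤-refl
  ind-mono {true} {false} h = contradiction _ h

find-or-empty : (A : VSet d) → (∃[ a ] T (A a)) ⊎ (card A ≡ 0)
find-or-empty {d} A with filterᵇ A (allVecs d) in eq
... | [] = inj₂ refl
... | _ ∷ _ = inj₁ (member (allVecs d) eq)
  where
  member : ∀ xs {y ys} → filterᵇ A xs ≡ y ∷ ys → ∃[ a ] T (A a)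
  member (x ∷ xs) e with A x in Ax
  ... | true = x , subst T (sym Ax) _
  ... | false = member xs e

-- The empty set meets every bound, so a member may be assumed. That member serves as the reference
-- point in `card-≤1`, `card-SamePart` and `card-Cross`.
card-≤-inhabited : (A : VSet d) {s : ℕ} → (∀ a → T (A a) → card A ≤ s) → card A ≤ s
card-≤-inhabited A h with find-or-empty A
... | inj₁ (a , Aa) = h a Aa
... | inj₂ empty = ≤-trans (≤-reflexive empty) z≤n

-- Boolean-valued, so that the section `v ==_` is itself a `VSet`, the singleton of `v`.
_==_ : F₂^ d → F₂^ d → Bool
[] == [] = true
(a ∷ v) == (b ∷ w) = not (a xor b) ∧ (v == w)

==-refl : (v : F₂^ d) → T (v == v)
==-refl [] = _
==-refl (true ∷ v) = ==-refl v
==-refl (false ∷ v) = ==-refl v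

==⇒≡ : (v w : F₂^ d) → T (v == w) → v ≡ w
==⇒≡ [] [] _ = refl
==⇒≡ (true ∷ v) (true ∷ w) e = cong (true ∷_) (==⇒≡ v w e)
==⇒≡ (false ∷ v) (false ∷ w) e = cong (false ∷_) (==⇒≡ v w e)

filterᵇ-∅ : {A : Set} (xs : List A) → filterᵇ (λ _ → false) xs ≡ []
filterᵇ-∅ [] = refl
filterᵇ-∅ (x ∷ xs) = filterᵇ-∅ xs

filterᵇ-singleton : (v : F₂^ d) → filterᵇ (v ==_) (allVecs d) ≡ v ∷ []
filterᵇ-singleton [] = refl
filterᵇ-singleton {suc d} (true ∷ v) =
  trans (filterᵇ-allVecs ((true ∷ v) ==_))
        (cong₂ (λ xs ys → map (false ∷_) xs ++ map (true ∷_) ys) (filterᵇ-∅ (allVecs d)) (filterᵇ-singleton v))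
filterᵇ-singleton {suc d} (false ∷ v) =
  trans (filterᵇ-allVecs ((false ∷ v) ==_))
        (cong₂ (λ xs ys → map (false ∷_) xs ++ map (true ∷_) ys) (filterᵇ-singleton v) (filterᵇ-∅ (allVecs d)))

card-≤1 : (A : VSet d) → (∀ v w → T (A v) → T (A w) → v ≡ w) → card A ≤ 1
card-≤1 A unique = card-≤-inhabited A λ a Aa →
  ≤-trans (card-mono (λ v Av → subst (λ w → T (a == w)) (unique a v Aa Av) (==-refl a)))
          (≤-reflexive (cong length (filterᵇ-singleton a)))

-- Transversals of a partition reduction of the binary matroid

-- A vector in both sets is dropped on the left and occurs twice on the right, where it cancels
-- because `x ⊕ x` is zero.
foldr-⊕-xor : (A B : VSet d) (xs : List (F₂^ d)) →
  foldr _⊕_ (zeroVec d) (filterᵇ (λ v → A v xor B v) xs) ≡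
  foldr _⊕_ (zeroVec d) (filterᵇ A xs) ⊕ foldr _⊕_ (zeroVec d) (filterᵇ B xs)
foldr-⊕-xor A B [] = sym (⊕-identityˡ _)
foldr-⊕-xor {d} A B (x ∷ xs) with A x | B x | foldr-⊕-xor A B xs
... | false | false | ih = ih
... | true | false | ih = trans (cong (x ⊕_) ih) (sym (⊕-assoc x _ _))
... | false | true | ih =
  trans (cong (x ⊕_) ih)
  (trans (sym (⊕-assoc x _ _)) (trans (cong (_⊕ _) (⊕-comm x _)) (⊕-assoc _ x _)))
... | true | true | ih =
  trans ih (sym (trans (⊕-assoc x _ _) (trans (cong (x ⊕_)
    (trans (sym (⊕-assoc _ x _)) (trans (cong (_⊕ _) (⊕-comm _ x)) (⊕-assoc x _ _)))) (⊕-cancel x _))))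

vsum-xor : (A B : VSet d) → vsum (λ v → A v xor B v) ≡ vsum A ⊕ vsum B
vsum-xor {d} A B = foldr-⊕-xor A B (allVecs d)

vsum-∅ : ∀ d → vsum {d} (λ _ → false) ≡ zeroVec d
vsum-∅ d = cong (foldr _⊕_ (zeroVec d)) (filterᵇ-∅ (allVecs d))

vsum-singleton : (v : F₂^ d) → vsum (v ==_) ≡ v
vsum-singleton {d} v =
  trans (cong (foldr _⊕_ (zeroVec d)) (filterᵇ-singleton v)) (zipWith-identityʳ xor-idʳ v)
  where
  xor-idʳ : ∀ a → a xor false ≡ a
  xor-idʳ a = xor-comm a false

-- The symmetric difference of the singletons, so that vsum is additive whether or not
-- the vectors are distinct.
oddSet : List (F₂^ d) → VSet d
oddSet [] v = false
oddSet (w ∷ ws) v = (w == v) xor oddSet ws v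

vsum-oddSet : (ws : List (F₂^ d)) → vsum (oddSet ws) ≡ foldr _⊕_ (zeroVec d) ws
vsum-oddSet {d} [] = vsum-∅ d
vsum-oddSet (w ∷ ws) =
  trans (vsum-xor (w ==_) (oddSet ws)) (cong₂ _⊕_ (vsum-singleton w) (vsum-oddSet ws))

module _ {d : ℕ} (P : Parts d) (P-red : IsReduction P) where

  same-part : ∀ {i j v} → T (P i v) → T (P j v) → i ≡ j
  same-part {i} {j} {v} pi pj with i ≟ j
  ... | yes i≡j = i≡j
  ... | no i≢j = contradiction pj (λ pj → proj₁ P-red i j i≢j v pi pj)

  InPart : Fin d × F₂^ d → Set
  InPart (i , v) = T (P i v)

  -- A vector that survives the symmetric difference occurs in the list; the entry found also
  -- carries the label of a part containing it.
  oddSet-member : ∀ {qs v} → All InPart qs → T (oddSet (map proj₂ qs) v) →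
    ∃[ i ] (T (P i v) × (i , v) ∈ qs)
  oddSet-member {(i , w) ∷ qs} {v} (p ∷ ps) h with w == v in eq
  ... | false = let j , pj , m = oddSet-member ps h in j , pj , there m
  ... | true with refl ← ==⇒≡ w v (subst T (sym eq) _) = i , p , here refl

  unique-vector : ∀ {qs : List (Fin d × F₂^ d)} {i v w} → Unique (map proj₁ qs) →
    (i , v) ∈ qs → (i , w) ∈ qs → v ≡ w
  unique-vector _ (here refl) (here refl) = refl
  unique-vector (i∉ ∷ _) (here refl) (there m) = contradiction refl (All.lookup i∉ (∈-map⁺ proj₁ m))
  unique-vector (i∉ ∷ _) (there m) (here refl) = contradiction refl (All.lookup i∉ (∈-map⁺ proj₁ m))
  unique-vector (_ ∷ u) (there m) (there m′) = unique-vector u m m′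

  -- Two members in the same part come from list entries with the same label, and labels do not
  -- repeat, so the two coincide.
  oddSet-independent : ∀ {qs} → Unique (map proj₁ qs) → All InPart qs → IndepP P (oddSet (map proj₂ qs))
  oddSet-independent {qs} u ps =
    (λ v Sv → let i , pi , _ = oddSet-member ps Sv in any⁺ (λ i → P i v) (lose (∈-allFin i) pi)) ,
    λ i → card-≤1 _ λ v w v∈ w∈ → unique-vector u (located i v v∈) (located i w w∈)
    where
    located : ∀ i v → T (oddSet (map proj₂ qs) v ∧ P i v) → (i , v) ∈ qs
    located i v h with Sv , pi ← ∧-split h with j , pj , m ← oddSet-member ps Sv =
      subst (λ k → (k , v) ∈ qs) (same-part pj pi) m

  -- Independence is applied to the whole set `S`: a zero sum would make it empty. But the head `v`
  -- stays in `S`, since the other entries lie in parts other than that of `v` and cannot cancel it.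
  transversal-sum-nonzero : ∀ q qs → Unique (map proj₁ (q ∷ qs)) → All InPart (q ∷ qs) →
    foldr _⊕_ (zeroVec d) (map proj₂ (q ∷ qs)) ≢ zeroVec d
  transversal-sum-nonzero q@(i , v) qs u@(i∉ ∷ _) ps@(p ∷ ps′) sum≡0 =
    contradiction (subst (1 ≤_) card≡0 1≤card) λ ()
    where
    S = oddSet (map proj₂ (q ∷ qs))

    card≡0 : card S ≡ 0
    card≡0 = proj₂ P-red S (oddSet-independent u ps) S (λ _ Sw → Sw)
      (trans (vsum-oddSet (map proj₂ (q ∷ qs))) sum≡0)

    v∉qs : ¬ T (oddSet (map proj₂ qs) v)
    v∉qs h with j , pj , m ← oddSet-member ps′ h =
      contradiction (same-part p pj) (All.lookup i∉ (∈-map⁺ proj₁ m))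

    xor-intro : ∀ {a b} → T a → ¬ T b → T (a xor b)
    xor-intro {true} {false} _ _ = _
    xor-intro {true} {true} _ ¬b = ¬b _

    v∈S : ∀ w → T (v == w) → T (S w)
    v∈S w e with refl ← ==⇒≡ v w e = xor-intro e v∉qs

    1≤card : 1 ≤ card S
    1≤card = subst (_≤ card S) (cong length (filterᵇ-singleton v)) (card-mono v∈S)

  -- The union of the small parts

  module _ (Tₛ : Subset d) (s : ℕ) (small : ∀ i → T (lookup Tₛ i) → card (P i) ≤ s) where

    private
      U : VSet d
      U = unionOver Tₛ P

    -- Only parts selected by `Tₛ` count, so that a common part is known to have at most `s`
    -- elements.
    SamePart : F₂^ d → VSet d
    SamePart x y = any (λ i → lookup Tₛ i ∧ (P i x ∧ P i y)) (allFin d)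

    card-SamePart : ∀ x → card (SamePart x) ≤ s
    card-SamePart x = card-≤-inhabited (SamePart x) λ a Sa →
      let i , i∈T , xi , _ = unpack a Sa in
      ≤-trans (card-mono λ y Sy → let j , _ , xj , yj = unpack y Sy in
                subst (λ k → T (P k y)) (same-part xj xi) yj)
              (small i i∈T)
      where
      unpack : ∀ y → T (SamePart x y) → ∃[ i ] (T (lookup Tₛ i) × T (P i x) × T (P i y))
      unpack y h with i , h′ ← satisfied (any⁻ _ (allFin d) h) with i∈T , h″ ← ∧-split h′ =
        i , i∈T , ∧-split h″

    -- A pair with sum `t` is represented by its first vector `x`, the second being `t ⊕ x`.
    Cross : F₂^ d → VSet d
    Cross t x = (U x ∧ U (t ⊕ x)) ∧ not (SamePart x (t ⊕ x))

    cross-parts : ∀ {t x} → T (Cross t x) → ∃[ i ] ∃[ j ]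
      (T (lookup Tₛ i) × T (lookup Tₛ j) × i ≢ j × T (P i x) × T (P j (t ⊕ x)))
    cross-parts {t} {x} h with UU , ¬same ← ∧-split h
      with Ux , Uy ← ∧-split UU
      with i , hi ← satisfied (any⁻ _ (allFin d) Ux)
         | j , hj ← satisfied (any⁻ _ (allFin d) Uy)
      with i∈T , xi ← ∧-split hi | j∈T , yj ← ∧-split hj =
      i , j , i∈T , j∈T , i≢j , xi , yj
      where
      not-elim : ∀ {b} → T (not b) → ¬ T b
      not-elim {false} _ ()

      i≢j : i ≢ j
      i≢j refl = not-elim ¬same
        (any⁺ (λ k → lookup Tₛ k ∧ (P k x ∧ P k (t ⊕ x))) (lose (∈-allFin i) (∧-join i∈T (∧-join xi yj))))

    -- A pair with sum `t` contributes `t` whatever `x` is, so two pairs with the same `t` add up to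
    -- zero.
    pair-sum : ∀ (x t r : F₂^ d) → x ⊕ ((t ⊕ x) ⊕ r) ≡ t ⊕ r
    pair-sum x t r = trans (sym (⊕-assoc x (t ⊕ x) r))
      (cong (_⊕ r) (trans (cong (x ⊕_) (⊕-comm t x)) (⊕-cancel x t)))

    -- Fix one cross pair `a`, `t ⊕ a`, in parts `i` and `j`. Every cross pair for `t` has one of
    -- its two vectors in one of these two parts, and each of the four possibilities accounts for at
    -- most `s` values of `x`.
    card-Cross : ∀ t → card (Cross t) ≤ (s + s) + (s + s)
    card-Cross t = card-≤-inhabited (Cross t) bound
      where
      ind≤ : ∀ {b m} → (T b → 1 ≤ m) → ind b ≤ m
      ind≤ {true} h = h _
      ind≤ {false} _ = z≤n

      bound : ∀ a → T (Cross t a) → card (Cross t) ≤ (s + s) + (s + s)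
      bound a Ca with i , j , i∈T , j∈T , i≢j , ai , bj ← cross-parts {t} {a} Ca = begin
        card (Cross t)                                  ≡⟨ card≡∑ᵥ (Cross t) ⟩
        ∑ᵥ (ind ∘ Cross t)                              ≤⟨ ∑ᵥ-mono (λ x → ind≤ (meets x)) ⟩
        ∑ᵥ (λ x → (I x + J x) + (I (t ⊕ x) + J (t ⊕ x))) ≡⟨ ∑ᵥ-+ (λ x → I x + J x) _ ⟩
        ∑ᵥ (λ x → I x + J x) + ∑ᵥ (λ x → I (t ⊕ x) + J (t ⊕ x))
          ≡⟨ cong (∑ᵥ (λ x → I x + J x) +_) (∑ᵥ-shiftˡ t (λ x → I x + J x)) ⟩
        ∑ᵥ (λ x → I x + J x) + ∑ᵥ (λ x → I x + J x)     ≡⟨ cong₂ _+_ (∑ᵥ-+ I J) (∑ᵥ-+ I J) ⟩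
        (∑ᵥ I + ∑ᵥ J) + (∑ᵥ I + ∑ᵥ J)                   ≤⟨ +-mono-≤ (+-mono-≤ ∑I ∑J) (+-mono-≤ ∑I ∑J) ⟩
        (s + s) + (s + s)                               ∎
        where
        open ≤-Reasoning
        I J : F₂^ d → ℕ
        I = ind ∘ P i
        J = ind ∘ P j

        ∑I : ∑ᵥ I ≤ s
        ∑I = subst (_≤ s) (card≡∑ᵥ (P i)) (small i i∈T)

        ∑J : ∑ᵥ J ≤ s
        ∑J = subst (_≤ s) (card≡∑ᵥ (P j)) (small j j∈T)

        1≤ind : ∀ {k l v} → k ≡ l → T (P l v) → 1 ≤ ind (P k v)
        1≤ind refl p = ≤-reflexive (sym (ind-T p))

        meets : ∀ x → T (Cross t x) → 1 ≤ (I x + J x) + (I (t ⊕ x) + J (t ⊕ x))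
        meets x Cx with k , l , _ , _ , k≢l , xk , yl ← cross-parts {t} {x} Cx
          with i ≟ k | j ≟ k | i ≟ l | j ≟ l
        ... | yes e | _ | _ | _ = m≤n⇒m≤n+o _ (m≤n⇒m≤n+o _ (1≤ind e xk))
        ... | _ | yes e | _ | _ = m≤n⇒m≤n+o _ (m≤n⇒m≤o+n (I x) (1≤ind e xk))
        ... | _ | _ | yes e | _ = m≤n⇒m≤o+n (I x + J x) (m≤n⇒m≤n+o _ (1≤ind e yl))
        ... | _ | _ | _ | yes e = m≤n⇒m≤o+n (I x + J x) (m≤n⇒m≤o+n (I (t ⊕ x)) (1≤ind e yl))
        -- Here the parts `i`, `j`, `k`, `l` are pairwise distinct, so the two pairs form a
        -- transversal, yet their sum is `t ⊕ t`.
        ... | no i≢k | no j≢k | no i≢l | no j≢l = contradiction sum≡0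
          (transversal-sum-nonzero (i , a) ((j , t ⊕ a) ∷ (k , x) ∷ (l , t ⊕ x) ∷ [])
            ((i≢j ∷ i≢k ∷ i≢l ∷ []) ∷ (j≢k ∷ j≢l ∷ []) ∷ (k≢l ∷ []) ∷ [] ∷ [])
            (ai ∷ bj ∷ xk ∷ yl ∷ []))
          where
          sum≡0 : a ⊕ ((t ⊕ a) ⊕ (x ⊕ ((t ⊕ x) ⊕ zeroVec d))) ≡ zeroVec d
          sum≡0 = trans (cong (λ r → a ⊕ ((t ⊕ a) ⊕ r)) (pair-sum x t (zeroVec d)))
            (trans (pair-sum a t _) (⊕-cancel t (zeroVec d)))

    -- Counts the pairs in `U` × `U` twice over: those within a part for each fixed `x`, the cross
    -- pairs for each fixed sum `t`.
    card-unionOver² : card U * card U ≤ 5 * (s * 2 ^ d)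
    card-unionOver² = begin
      card U * card U
        ≡⟨ cong₂ _*_ (card≡∑ᵥ U) (card≡∑ᵥ U) ⟩
      ∑ᵥ (ind ∘ U) * ∑ᵥ (ind ∘ U)
        ≡⟨ sym (∑ᵥ-*ʳ (ind ∘ U) _) ⟩
      ∑ᵥ (λ x → ind (U x) * ∑ᵥ (ind ∘ U))
        -- The second vector of the pair is rewritten as `t ⊕ x`, with `t` running over the whole
        -- space.
        ≡⟨ ∑ᵥ-cong (λ x → trans (cong (ind (U x) *_) (sym (∑ᵥ-shiftʳ x (ind ∘ U)))) (sym (∑ᵥ-*ˡ (ind (U x)) (λ t → ind (U (t ⊕ x)))))) ⟩
      ∑ᵥ (λ x → ∑ᵥ (λ t → ind (U x) * ind (U (t ⊕ x))))
        ≤⟨ ∑ᵥ-mono (λ x → ∑ᵥ-mono (λ t → split (U x) (U (t ⊕ x)) (SamePart x (t ⊕ x)))) ⟩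
      ∑ᵥ (λ x → ∑ᵥ (λ t → D x (t ⊕ x) + C t x))
        ≡⟨ ∑ᵥ-cong (λ x → ∑ᵥ-+ (λ t → D x (t ⊕ x)) (λ t → C t x)) ⟩
      ∑ᵥ (λ x → ∑ᵥ (λ t → D x (t ⊕ x)) + ∑ᵥ (λ t → C t x))
        ≡⟨ ∑ᵥ-+ (λ x → ∑ᵥ (λ t → D x (t ⊕ x))) _ ⟩
      ∑ᵥ (λ x → ∑ᵥ (λ t → D x (t ⊕ x))) + ∑ᵥ (λ x → ∑ᵥ (λ t → C t x))
        -- The same-part term is translated back to a sum over the second vector; in the cross term
        -- the summations are exchanged so that `t` is outermost.
        ≡⟨ cong₂ _+_ (∑ᵥ-cong (λ x → trans (∑ᵥ-shiftʳ x (D x)) (sym (card≡∑ᵥ (SamePart x)))))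
                     (trans (∑ᵥ-swap (λ x t → C t x)) (∑ᵥ-cong (λ t → sym (card≡∑ᵥ (Cross t))))) ⟩
      ∑ᵥ (λ x → card (SamePart x)) + ∑ᵥ (λ t → card (Cross t))
        ≤⟨ +-mono-≤ (∑ᵥ-≤const s card-SamePart) (∑ᵥ-≤const _ card-Cross) ⟩
      2 ^ d * s + 2 ^ d * ((s + s) + (s + s))
        ≡⟨ five (2 ^ d) s ⟩
      5 * (s * 2 ^ d) ∎
      where
      open ≤-Reasoning
      D C : F₂^ d → F₂^ d → ℕ
      D x y = ind (SamePart x y)
      C t x = ind (Cross t x)

      split : ∀ a b c → ind a * ind b ≤ ind c + ind ((a ∧ b) ∧ not c)
      split false _ _ = z≤n
      split true false _ = z≤n
      split true true false = ≤-refl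
      split true true true = ≤-refl

      five : ∀ m s → m * s + m * ((s + s) + (s + s)) ≡ 5 * (s * m)
      five = solve-∀

  -- The number of large parts

  sum-card : ∀ {n} (Q : Fin n → VSet d) → sum (λ i → card (Q i)) ≡ ∑ᵥ (λ v → sum (λ i → ind (Q i v)))
  sum-card {zero} Q = sym (trans (∑ᵥ-const d 0) (*-zeroʳ (2 ^ d)))
  sum-card {suc n} Q = trans (cong₂ _+_ (card≡∑ᵥ (Q zero)) (sum-card (Q ∘ suc))) (sym (∑ᵥ-+ (ind ∘ Q zero) _))

  sum-ind≤1 : ∀ {n} (b : Fin n → Bool) → (∀ i j → T (b i) → T (b j) → i ≡ j) → sum (ind ∘ b) ≤ 1
  sum-ind≤1 {zero} b _ = z≤n
  sum-ind≤1 {suc n} b unique with b zero in eq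
  ... | false = sum-ind≤1 (b ∘ suc) (λ i j bi bj → Fin-suc-injective (unique (suc i) (suc j) bi bj))
  ... | true = s≤s (≤-reflexive (none (b ∘ suc) (λ i bi → contradiction (unique zero (suc i) (subst T (sym eq) _) bi) λ ())))
    where
    none : ∀ {m} (c : Fin m → Bool) → (∀ i → ¬ T (c i)) → sum (ind ∘ c) ≡ 0
    none {zero} c _ = refl
    none {suc m} c h with c zero in eq
    ... | false = none (c ∘ suc) (h ∘ suc)
    ... | true = contradiction (subst T (sym eq) _) (h zero)

  -- After exchanging the summations, disjointness lets each of the `2 ^ d` vectors be counted at
  -- most once.
  sum-parts≤ : sum (λ i → card (P i)) ≤ 2 ^ d
  sum-parts≤ = begin
    sum (λ i → card (P i))                ≡⟨ sum-card P ⟩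
    ∑ᵥ (λ v → sum (λ i → ind (P i v)))     ≤⟨ ∑ᵥ-≤const 1 (λ v → sum-ind≤1 (λ i → P i v) (λ i j → same-part)) ⟩
    2 ^ d * 1                             ≡⟨ *-identityʳ (2 ^ d) ⟩
    2 ^ d                                 ∎
    where open ≤-Reasoning

-- Each index left out of the subset has value above `s`, hence contributes at least `suc s` to the
-- sum.
large-count : ∀ {n} (a : Fin n → ℕ) s → (n ∸ ∣ tabulate (λ i → a i ≤ᵇ s) ∣) * suc s ≤ sum a
large-count {zero} a s = z≤n
large-count {suc n} a s with a zero ≤ᵇ s in eq
... | true = m≤n⇒m≤o+n (a zero) (large-count (a ∘ suc) s)
... | false = begin
  -- Truncated subtraction lets the successor out only because a subset of `n` indices has size at
  -- most `n`.
  (suc n ∸ ∣ t ∣) * suc s           ≡⟨ cong (_* suc s) (+-∸-assoc 1 (∣p∣≤n t)) ⟩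
  suc s + (n ∸ ∣ t ∣) * suc s       ≤⟨ +-mono-≤ (≰⇒> (λ a≤s → subst T eq (≤⇒≤ᵇ a≤s))) (large-count (a ∘ suc) s) ⟩
  a zero + sum (a ∘ suc)           ∎
  where
  open ≤-Reasoning
  t = tabulate (λ i → a (suc i) ≤ᵇ s)

-- The threshold and the final estimates

crossing : (f : ℕ → ℕ) (m n : ℕ) → f 0 ≤ m → m < f n → ∃[ s ] (f s ≤ m × m < f (suc s))
crossing f m zero f0≤m m<f0 = contradiction f0≤m (<⇒≱ m<f0)
-- The search runs downwards and stops at the first `n` where `f n` no longer exceeds `m`.
crossing f m (suc n) f0≤m m<f with m <? f n
... | yes m<fn = crossing f m n f0≤m m<fn
... | no m≮fn = n , ≮⇒≥ m≮fn , m<f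

-- Both bounds are stated without roots: the first is d - |T| ≤ 8√d squared, the second is the bound
-- on the union raised to the fourth power and multiplied by `d`.
mainTheorem1 : (d : ℕ) → 1 ≤ d → (P : Parts d) → IsReduction P →
    ∃[ Tₛ ] (((d ∸ ∣ Tₛ ∣) ^ 2 ≤ 64 * d) ×
    (card (unionOver Tₛ P) ^ 4 * d ≤ 2 ^ (4 * d)))
mainTheorem1 d 1≤d P P-red = Tₛ , few-large , small-union
  where
  open ≤-Reasoning
  N = 2 ^ d

  f : ℕ → ℕ
  f s = (s * s) * (64 * d)

  N²<f : N * N < f (suc N)
  N²<f = begin-strict
    N * N                  <⟨ *-mono-< (n<1+n N) (n<1+n N) ⟩
    suc N * suc N          ≡⟨ sym (*-identityʳ _) ⟩
    (suc N * suc N) * 1    ≤⟨ *-monoʳ-≤ (suc N * suc N) (≤-trans 1≤d (m≤m+n d (63 * d))) ⟩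
    f (suc N)              ∎

  -- `s` is 2^d / (8√d) rounded down. The lower inequality makes the union of small parts small, the
  -- upper one makes large parts few.
  threshold : ∃[ s ] (f s ≤ N * N × N * N < f (suc s))
  threshold = crossing f (N * N) (suc N) z≤n N²<f

  s = proj₁ threshold

  Tₛ : Subset d
  Tₛ = tabulate (λ i → card (P i) ≤ᵇ s)

  m = d ∸ ∣ Tₛ ∣
  u = card (unionOver Tₛ P)

  m*[1+s]≤N : m * suc s ≤ N
  m*[1+s]≤N = ≤-trans (large-count (λ i → card (P i)) s) (sum-parts≤ P P-red)

  few-large : m ^ 2 ≤ 64 * d
  -- The factor (s+1)² is cancelled from (s+1)² m² ≤ N² < (s+1)² · 64 d.
  few-large = <⇒≤ (*-cancelˡ-< (suc s * suc s) _ _ (begin-strict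
    (suc s * suc s) * m ^ 2       ≡⟨ rearrange m (suc s) ⟩
    (m * suc s) * (m * suc s)     ≤⟨ *-mono-≤ m*[1+s]≤N m*[1+s]≤N ⟩
    N * N                         <⟨ proj₂ (proj₂ threshold) ⟩
    (suc s * suc s) * (64 * d)    ∎))
    where
    rearrange : ∀ m r → (r * r) * (m * (m * 1)) ≡ (m * r) * (m * r)
    rearrange = solve-∀

  u²≤5sN : u * u ≤ 5 * (s * N)
  u²≤5sN = card-unionOver² P P-red Tₛ s λ i i∈T →
    ≤ᵇ⇒≤ _ s (subst T (lookup∘tabulate (λ i → card (P i) ≤ᵇ s) i) i∈T)

  small-union : u ^ 4 * d ≤ 2 ^ (4 * d)
  small-union = begin
    u ^ 4 * d                                ≡⟨ square u d ⟩
    (u * u) * (u * u) * d                    ≤⟨ *-monoˡ-≤ d (*-mono-≤ u²≤5sN u²≤5sN) ⟩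
    5 * (s * N) * (5 * (s * N)) * d          ≡⟨ rearrange s N d ⟩
    -- The constant 25 = 5² from the pair count is enlarged to 64 to match `f s`.
    (s * s) * (25 * d) * (N * N)             ≤⟨ *-monoˡ-≤ (N * N) (*-monoʳ-≤ (s * s) (*-monoˡ-≤ d (m≤m+n 25 39))) ⟩
    f s * (N * N)                            ≤⟨ *-monoˡ-≤ (N * N) (proj₁ (proj₂ threshold)) ⟩
    (N * N) * (N * N)                        ≡⟨ fourth N ⟩
    N ^ 4                                    ≡⟨ ^-*-assoc 2 d 4 ⟩
    2 ^ (d * 4)                              ≡⟨ cong (2 ^_) (*-comm d 4) ⟩
    2 ^ (4 * d)                              ∎
    where
    square : ∀ u d → u * (u * (u * (u * 1))) * d ≡ (u * u) * (u * u) * d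
    square = solve-∀
    rearrange : ∀ s N d → 5 * (s * N) * (5 * (s * N)) * d ≡ (s * s) * (25 * d) * (N * N)
    rearrange = solve-∀
    fourth : ∀ N → (N * N) * (N * N) ≡ N * (N * (N * (N * 1)))
    fourth = solve-∀
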